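{- Let $X$, $Y$ be graphs and let $\varphi:X\rightarrow Y$ be a locally surjective homomorphism. (i) If $C\in\mathcal{C}(X)$, then $\varphi(C)\in\mathcal{C}(Y)$. In particular, the image $\varphi(X)$ of $X$ is a union of components of $Y$. (ii) For every $x\in V_X$, $\varphi(C_X(x))=C_Y(\varphi(x))\cong C_X(x)/\!\sim_{\varphi}$. (iii) For every $C\in\mathcal{C}(X)$, $\varphi^{ -1}(\varphi(V_C))=\bigcup_{\hat{C}\in\mathcal{C}(X)_{\varphi(C)}}V_{\hat{C}}$. (iv) For $1\leq i\leq c(Y)$, let $y_i\in V_Y$ be such that $\mathcal{C}(Y)=\{C_Y(y_i):1\leq i\leq c(Y)\}$. Then $$c(X)=\sum_{i=1}^{c(Y)}c(X)_{y_i}.$$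
   Context: All graphs are finite, undirected, simple and reflexive: a graph $X=(V_X,E_X)$ has a finite nonempty vertex set $V_X$, and $E_X$ consists of all loops $\{x\}$ ($x\in V_X$; written $\{x,x\}$) together with a (possibly empty) set of $2$-element subsets of $V_X$ (proper edges). A homomorphism $\varphi:X\to Y$ is a map $\varphi:V_X\to V_Y$ such that $\{x_1,x_2\}\in E_X$ implies $\{\varphi(x_1),\varphi(x_2)\}\in E_Y$ (a proper edge may be mapped to a loop); it induces a map $E_X\to E_Y$. For a subgraph $\hat X\subseteq X$, $\varphi(\hat X)$ is the subgraph of $Y$ with vertex set $\varphi(V_{\hat X})$ and edge set $\varphi(E_{\hat X})$. The neighbourhood of $x$ is $N_X(x)=\{u\in V_X:\{x,u\}\in E_X\}$ (so $x\in N_X(x)$). $\varphi$ is locally surjective if $\varphi(N_X(x))=N_Y(\varphi(x))$ for every $x\in V_X$ ($\varphi$ need not be surjective). $\cong$ denotes graph isomorphism (a bijective homomorphism that maps edges onto edges). A component of $X$ is a maximal connected subgraph (equivalently, the subgraph induced on a connectedness class); $C_X(x)$ is the component containing $x$, $\mathcal{C}(X)$ the set of components, $c(X)=|\mathcal{C}(X)|$. For $C'\in\mathcal{C}(Y)$, $\mathcal{C}(X)_{C'}=\{C\in\mathcal{C}(X):\varphi(C)\subseteq C'\}$, where $\subseteq$ means subgraph. For $y\in V_Y$ and a subgraph $\hat X$ of $X$, $k_{\hat X}(y)=|V_{\hat X}\cap\varphi^{ -1}(y)|$; $\mathcal{C}(X)_y=\{C\in\mathcal{C}(X):k_C(y)>0\}$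 and $c(X)_y=|\mathcal{C}(X)_y|$. $\sim_\varphi$ is the equivalence relation on $V_X$ given by $x\sim_\varphi x'$ iff $\varphi(x)=\varphi(x')$. For a graph $Z$ and an equivalence relation $\sim$ on $V_Z$, the quotient graph $Z/\!\sim$ has as vertices the equivalence classes $[z]$, and $\{[z_1],[z_2]\}$ is an edge iff there are $\tilde z_1\sim z_1$, $\tilde z_2\sim z_2$ with $\{\tilde z_1,\tilde z_2\}\in E_Z$. $C_X(x)/\!\sim_\varphi$ is the quotient of the graph $C_X(x)$ by the restriction of $\sim_\varphi$ to its vertices. -}

module Defs where

open import Data.Empty using (⊥-elim)
open import Data.List.Base using (List; []; _∷_; length; filter; deduplicate; map)
open import Data.List.Membership.Setoid using (lose)
open import Data.List.Membership.Setoid.Properties using (∈-map⁺)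
import Data.List.Relation.Unary.All as All
open import Data.List.Relation.Unary.Any as Any using (Any; here; there)
open import Data.List.Relation.Unary.Enumerates.Setoid using (IsEnumeration)
open import Data.Nat.Base using (ℕ; _>_)
open import Data.Nat.Properties using (_>?_)
open import Data.Product.Base using (Σ; Σ-syntax; ∃; ∃₂; _×_; _,_; proj₁; proj₂)
open import Data.Sum.Base using (_⊎_; inj₁; inj₂)
open import Data.Unit.Base using (⊤; tt)
open import Function.Base using (_on_; id)
open import Function.Bundles using (_⇔_)
open import Function.Definitions using (Congruent; Bijective)
open import Level using (Level; 0ℓ; suc; _⊔_)
open import Relation.Binary.Bundles using (DecSetoid)
open import Relation.Binary.Core using (Rel; _⇒_)
import Relation.Binary.Construct.On as On
open import Relation.Binary.Construct.Closure.ReflexiveTransitive using (Star; ε; _◅_; _◅◅_; gmap; reverse)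
import Relation.Binary.Definitions as B
open import Relation.Binary.Structures using (IsDecEquivalence)
open import Relation.Nullary.Decidable using (Dec; yes; no; map′; _×-dec_; _⊎-dec_; _→-dec_)
open import Relation.Unary using (Pred; Decidable; _≐_)

-- The enumeration may repeat elements, so cardinalities are taken after
-- removing duplicates.
record FiniteSet (c ℓ : Level) : Set (suc (c ⊔ ℓ)) where
  field
    decSetoid : DecSetoid c ℓ
  open DecSetoid decSetoid public
  field
    elements : List Carrier
    complete : IsEnumeration setoid elements

  representatives : List Carrier
  representatives = deduplicate _≟_ elements

  card : ℕ
  card = length representatives

  -- Cardinality of a decidable subset; meaningful for P respecting _≈_.
  # : ∀ {p} {P : Pred Carrier p} → Decidable P → ℕ
  # P? = length (filter P? representatives)

  ∃? : ∀ {p} {P : Pred Carrier p} → P B.Respects _≈_ → Decidable P → Dec (∃ P)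
  ∃? resp P? = map′ Any.satisfied
    (λ (x , px) → lose setoid resp (complete x) px)
    (Any.any? P? elements)

  ∀? : ∀ {p} {P : Pred Carrier p} → P B.Respects _≈_ → Decidable P → Dec (∀ x → P x)
  ∀? resp P? = map′
    (λ all x → All.lookupₛ setoid resp all (complete x))
    (λ f → All.universal f elements)
    (All.all? P? elements)

-- The subset {x ∈ A ∣ P x}; two elements are equal when their underlying
-- elements of A are.
module _ {c ℓ p} (A : FiniteSet c ℓ) {P : Pred (FiniteSet.Carrier A) p}
         (P? : Decidable P) (resp : P B.Respects FiniteSet._≈_ A) where
  private
    module A = FiniteSet A

    keep : List A.Carrier → List (∃ P)
    keep [] = []
    keep (x ∷ xs) with P? x
    ... | yes px = (x , px) ∷ keep xs
    ... | no  _  = keep xs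

    keep-complete : ∀ {x} → P x → ∀ xs → Any (x A.≈_) xs →
                    Any (λ y → x A.≈ proj₁ y) (keep xs)
    keep-complete px (y ∷ ys) x∈ with P? y
    keep-complete px (y ∷ ys) (here x≈y)  | yes _  = here x≈y
    keep-complete px (y ∷ ys) (there x∈)  | yes _  = there (keep-complete px ys x∈)
    keep-complete px (y ∷ ys) (here x≈y)  | no ¬py = ⊥-elim (¬py (resp x≈y px))
    keep-complete px (y ∷ ys) (there x∈)  | no _   = keep-complete px ys x∈

  subset : FiniteSet (c ⊔ p) ℓ
  subset = record
    { decSetoid = On.decSetoid A.decSetoid proj₁
    ; elements  = keep A.elements
    ; complete  = λ (x , px) → keep-complete px A.elements (A.complete x)
    }

-- {x , y} is an edge iff Edge x y. Equality of vertices is a decidable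
-- setoid equality so that quotients are again graphs.
record Graph : Set₁ where
  field
    vertices : FiniteSet 0ℓ 0ℓ
  open FiniteSet vertices public
    using (_≈_; _≟_; setoid; elements; complete; #; ∃?; ∀?)
    renaming ( Carrier to Vertex; refl to ≈-refl; sym to ≈-sym; trans to ≈-trans
             ; isDecEquivalence to ≈-isDecEquivalence )
  field
    nonempty  : Vertex
    Edge      : Rel Vertex 0ℓ
    Edge?     : B.Decidable Edge
    Edge-resp : Edge B.Respects₂ _≈_
    Edge-refl : B.Reflexive Edge
    Edge-sym  : B.Symmetric Edge

  ≈⇒Edge : _≈_ ⇒ Edge
  ≈⇒Edge x≈y = proj₁ Edge-resp x≈y Edge-refl

N : (X : Graph) → Graph.Vertex X → Pred (Graph.Vertex X) 0ℓ
N X x u = Graph.Edge X x u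

Connected : Graph → Set
Connected G = ∀ x y → Star (Graph.Edge G) x y

record Subgraph (X : Graph) : Set₁ where
  private module X = Graph X
  field
    V        : Pred X.Vertex 0ℓ
    V?       : Decidable V
    V-resp   : V B.Respects X._≈_
    nonempty : ∃ V
    E        : Rel X.Vertex 0ℓ
    E?       : B.Decidable E
    E-resp   : E B.Respects₂ X._≈_
    E-refl   : ∀ {x} → V x → E x x
    E-sym    : B.Symmetric E
    E⇒V      : ∀ {x y} → E x y → V x
    E⇒Edge   : E ⇒ X.Edge

open Subgraph using (V; E)

⌞_⌟ : {X : Graph} → Subgraph X → Graph
⌞_⌟ {X} S = record
  { vertices  = subset X.vertices S.V? S.V-resp
  ; nonempty  = S.nonempty
  ; Edge      = S.E on proj₁
  ; Edge?     = λ x y → S.E? (proj₁ x) (proj₁ y)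
  ; Edge-resp = proj₁ S.E-resp , proj₂ S.E-resp
  ; Edge-refl = λ {x} → S.E-refl (proj₂ x)
  ; Edge-sym  = S.E-sym
  }
  where
  module X = Graph X
  module S = Subgraph S

whole : (X : Graph) → Subgraph X
whole X = record
  { V        = λ _ → ⊤
  ; V?       = λ _ → yes tt
  ; V-resp   = λ _ _ → tt
  ; nonempty = X.nonempty , tt
  ; E        = X.Edge
  ; E?       = X.Edge?
  ; E-resp   = X.Edge-resp
  ; E-refl   = λ _ → X.Edge-refl
  ; E-sym    = X.Edge-sym
  ; E⇒V      = λ _ → tt
  ; E⇒Edge   = id
  }
  where module X = Graph X

infix 4 _⊆_ _≋_

record _⊆_ {X : Graph} (S T : Subgraph X) : Set where
  constructor mk⊆
  field
    V⊆ : ∀ {x} → V S x → V T x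
    E⊆ : ∀ {x y} → E S x y → E T x y

open _⊆_ public

_≋_ : {X : Graph} → Rel (Subgraph X) 0ℓ
S ≋ T = S ⊆ T × T ⊆ S

⊆-refl : {X : Graph} {S : Subgraph X} → S ⊆ S
⊆-refl = mk⊆ id id

⊆-trans : {X : Graph} {S T U : Subgraph X} → S ⊆ T → T ⊆ U → S ⊆ U
⊆-trans p q = mk⊆ (λ v → V⊆ q (V⊆ p v)) (λ e → E⊆ q (E⊆ p e))

_⊆?_ : {X : Graph} → B.Decidable (_⊆_ {X})
_⊆?_ {X} S T = map′
  (λ (v , e) → mk⊆ (λ {x} → v x) (λ {x} {y} → e x y))
  (λ p → (λ x → V⊆ p {x}) , (λ x y → E⊆ p {x} {y}))
  (   X.∀? (λ x≈y f v → T.V-resp x≈y (f (S.V-resp (X.≈-sym x≈y) v)))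
        (λ x → S.V? x →-dec T.V? x)
  ×-dec
      X.∀? (λ x≈x′ f y e → proj₂ T.E-resp x≈x′ (f y (proj₂ S.E-resp (X.≈-sym x≈x′) e)))
        (λ x → X.∀? (λ y≈y′ f e → proj₁ T.E-resp y≈y′ (f (proj₁ S.E-resp (X.≈-sym y≈y′) e)))
          (λ y → S.E? x y →-dec T.E? x y)))
  where
  module X = Graph X
  module S = Subgraph S
  module T = Subgraph T

record IsComponent {X : Graph} (C : Subgraph X) : Set₁ where
  field
    connected : Connected ⌞ C ⌟
    maximal   : ∀ (D : Subgraph X) → Connected ⌞ D ⌟ → C ⊆ D → D ⊆ C

Component : Graph → Set₁
Component X = Σ (Subgraph X) IsComponent

-- Reachability by walks whose inner vertices lie in a given list, by
-- recursion on that list; this is how reachability is decided.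
module _ (X : Graph) where
  open Graph X
  private
    Via : List Vertex → Rel Vertex 0ℓ
    Via []       x y = Edge x y
    Via (v ∷ vs) x y = Via vs x y ⊎ (Via vs x v × Via vs v y)

    Via? : ∀ vs → B.Decidable (Via vs)
    Via? []       x y = Edge? x y
    Via? (v ∷ vs) x y = Via? vs x y ⊎-dec (Via? vs x v ×-dec Via? vs v y)

    Via-respʳ : ∀ vs {x y z} → y ≈ z → Via vs x y → Via vs x z
    Via-respʳ []       y≈z e              = proj₁ Edge-resp y≈z e
    Via-respʳ (v ∷ vs) y≈z (inj₁ p)       = inj₁ (Via-respʳ vs y≈z p)
    Via-respʳ (v ∷ vs) y≈z (inj₂ (p , q)) = inj₂ (p , Via-respʳ vs y≈z q)

    Via-respˡ : ∀ vs {x y z} → x ≈ z → Via vs x y → Via vs z y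
    Via-respˡ []       x≈z e              = proj₂ Edge-resp x≈z e
    Via-respˡ (v ∷ vs) x≈z (inj₁ p)       = inj₁ (Via-respˡ vs x≈z p)
    Via-respˡ (v ∷ vs) x≈z (inj₂ (p , q)) = inj₂ (Via-respˡ vs x≈z p , q)

    Edge⇒Via : ∀ vs → Edge ⇒ Via vs
    Edge⇒Via []       e = e
    Edge⇒Via (v ∷ vs) e = inj₁ (Edge⇒Via vs e)

    Via⇒Star : ∀ vs → Via vs ⇒ Star Edge
    Via⇒Star []       e              = e ◅ ε
    Via⇒Star (v ∷ vs) (inj₁ p)       = Via⇒Star vs p
    Via⇒Star (v ∷ vs) (inj₂ (p , q)) = Via⇒Star vs p ◅◅ Via⇒Star vs q

    Via-trans : ∀ vs {x v y} → Any (v ≈_) vs → Via vs x v → Via vs v y → Via vs x y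
    Via-trans (u ∷ us) (here v≈u) p q = inj₂ (to-u p , from-u q)
      where
      to-u : ∀ {x} → Via (u ∷ us) x _ → Via us x u
      to-u (inj₁ r)       = Via-respʳ us v≈u r
      to-u (inj₂ (r , _)) = r
      from-u : ∀ {y} → Via (u ∷ us) _ y → Via us u y
      from-u (inj₁ r)       = Via-respˡ us v≈u r
      from-u (inj₂ (_ , r)) = r
    Via-trans (u ∷ us) (there v∈) (inj₁ p)       (inj₁ q)       = inj₁ (Via-trans us v∈ p q)
    Via-trans (u ∷ us) (there v∈) (inj₁ p)       (inj₂ (q , r)) = inj₂ (Via-trans us v∈ p q , r)
    Via-trans (u ∷ us) (there v∈) (inj₂ (p , q)) (inj₁ r)       = inj₂ (p , Via-trans us v∈ q r)
    Via-trans (u ∷ us) (there v∈) (inj₂ (p , _)) (inj₂ (_ , r)) = inj₂ (p , r)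

    Star⇒Via : Star Edge ⇒ Via elements
    Star⇒Via ε        = Edge⇒Via elements Edge-refl
    Star⇒Via (e ◅ es) = Via-trans elements (complete _) (Edge⇒Via elements e) (Star⇒Via es)

  Star? : B.Decidable (Star Edge)
  Star? x y = map′ (Via⇒Star elements) Star⇒Via (Via? elements x y)

  -- The subgraph induced on the connectedness class of x.
  componentOf : Vertex → Subgraph X
  componentOf x = record
    { V        = Star Edge x
    ; V?       = Star? x
    ; V-resp   = λ y≈z p → p ◅◅ ≈⇒Edge y≈z ◅ ε
    ; nonempty = x , ε
    ; E        = λ y z → Star Edge x y × Edge y z
    ; E?       = λ y z → Star? x y ×-dec Edge? y z
    ; E-resp   = (λ z≈z′ (p , e) → p , proj₁ Edge-resp z≈z′ e)
               , (λ y≈y′ (p , e) → (p ◅◅ ≈⇒Edge y≈y′ ◅ ε) , proj₂ Edge-resp y≈y′ e)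
    ; E-refl   = λ p → p , Edge-refl
    ; E-sym    = λ (p , e) → (p ◅◅ e ◅ ε) , Edge-sym e
    ; E⇒V      = proj₁
    ; E⇒Edge   = proj₂
    }

module _ {X : Graph} where
  open Graph X
  open IsComponent

  walk : (S : Subgraph X) (a b : ∃ (V S)) → Star (Graph.Edge ⌞ S ⌟) a b → Star Edge (proj₁ a) (proj₁ b)
  walk S a b = gmap proj₁ (Subgraph.E⇒Edge S)

  connected⇒⊆ : (S : Subgraph X) → Connected ⌞ S ⌟ → ∀ {x} → V S x → S ⊆ componentOf X x
  connected⇒⊆ S conn {x} x∈S = mk⊆ reach
    (λ e → reach (Subgraph.E⇒V S e) , Subgraph.E⇒Edge S e)
    where
    reach : ∀ {y} → V S y → Star Edge x y
    reach y∈S = walk S (x , x∈S) (_ , y∈S) (conn _ _)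

  componentOf-isComponent : ∀ x → IsComponent (componentOf X x)
  componentOf-isComponent x = record
    { connected = λ (a , p) (b , q) → lift p q (reverse Edge-sym p ◅◅ q)
    ; maximal   = λ D conn C⊆D → connected⇒⊆ D conn (V⊆ C⊆D ε)
    }
    where
    lift : ∀ {a b} (p : Star Edge x a) (q : Star Edge x b) → Star Edge a b →
           Star (Graph.Edge ⌞ componentOf X x ⌟) (a , p) (b , q)
    lift p q ε        = (p , Edge-refl) ◅ ε
    lift p q (e ◅ es) = (p , e) ◅ lift (p ◅◅ e ◅ ε) q es

  component≋ : (C : Component X) → ∀ {x} → V (proj₁ C) x → proj₁ C ≋ componentOf X x
  component≋ (C , isC) {x} x∈C = C⊆ ,
    maximal isC (componentOf X x) (connected (componentOf-isComponent x)) C⊆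
    where
    C⊆ : C ⊆ componentOf X x
    C⊆ = connected⇒⊆ C (connected isC) x∈C

𝒞 : Graph → FiniteSet (suc 0ℓ) 0ℓ
𝒞 X = record
  { decSetoid = decSetoid
  ; elements  = map C[_] X.elements
  ; complete  = λ C@(S , _) → let (x , x∈S) = Subgraph.nonempty S in
      Any.map (λ {D} → DecSetoid.trans decSetoid {C} {C[ x ]} {D} (component≋ C x∈S))
        (∈-map⁺ X.setoid (DecSetoid.setoid decSetoid) {f = C[_]}
          (λ {x} {y} x≈y → component≋ C[ x ] (X.≈⇒Edge x≈y ◅ ε))
          (X.complete x))
  }
  where
  module X = Graph X
  C[_] : X.Vertex → Component X
  C[ x ] = componentOf X x , componentOf-isComponent x
  decSetoid : DecSetoid (suc 0ℓ) 0ℓ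
  decSetoid = record
    { Carrier = Component X
    ; _≈_ = _≋_ on proj₁
    ; isDecEquivalence = record
      { isEquivalence = record
        { refl  = ⊆-refl , ⊆-refl
        ; sym   = λ (p , q) → q , p
        ; trans = λ (p , q) (p′ , q′) → ⊆-trans p p′ , ⊆-trans q′ q
        }
      ; _≟_ = λ (S , _) (T , _) → (S ⊆? T) ×-dec (T ⊆? S)
      }
    }

c : Graph → ℕ
c X = FiniteSet.card (𝒞 X)

IsUnionOfComponents : {X : Graph} → Subgraph X → Set₂
IsUnionOfComponents {X} S = Σ[ 𝒮 ∈ Pred (Component X) (suc 0ℓ) ]
    (∀ x   → V S x   ⇔ (Σ[ C ∈ Component X ] 𝒮 C × V (proj₁ C) x))
  × (∀ x y → E S x y ⇔ (Σ[ C ∈ Component X ] 𝒮 C × E (proj₁ C) x y))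

record Hom (X Y : Graph) : Set where
  private
    module X = Graph X
    module Y = Graph Y
  field
    to   : X.Vertex → Y.Vertex
    cong : Congruent X._≈_ Y._≈_ to
    edge : ∀ {x₁ x₂} → X.Edge x₁ x₂ → Y.Edge (to x₁) (to x₂)

infix 4 _≅_

record _≅_ (X Y : Graph) : Set where
  private
    module X = Graph X
    module Y = Graph Y
  field
    hom : Hom X Y
  open Hom hom public
  field
    bijective : Bijective X._≈_ Y._≈_ to
    edge-onto : ∀ {y₁ y₂} → Y.Edge y₁ y₂ →
                ∃₂ λ x₁ x₂ → X.Edge x₁ x₂ × to x₁ Y.≈ y₁ × to x₂ Y.≈ y₂

module _ {X Y : Graph} (φ : Hom X Y) where
  private
    module X = Graph X
    module Y = Graph Y
    module φ = Hom φ

  imageSet : Pred X.Vertex 0ℓ → Pred Y.Vertex 0ℓ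
  imageSet P y = ∃ λ x → P x × φ.to x Y.≈ y

  preimageSet : Pred Y.Vertex 0ℓ → Pred X.Vertex 0ℓ
  preimageSet Q x = Q (φ.to x)

  LocallySurjective : Set
  LocallySurjective = ∀ x → imageSet (N X x) ≐ N Y (φ.to x)

  image : Subgraph X → Subgraph Y
  image S = record
    { V        = imageSet S.V
    ; V?       = λ y → X.∃?
        (λ x≈x′ (v , p) → S.V-resp x≈x′ v , along x≈x′ p)
        (λ x → S.V? x ×-dec (φ.to x Y.≟ y))
    ; V-resp   = λ y≈y′ (x , v , p) → x , v , Y.≈-trans p y≈y′
    ; nonempty = let (x , v) = S.nonempty in φ.to x , x , v , Y.≈-refl
    ; E        = λ y₁ y₂ → ∃ λ x₁ → ∃ λ x₂ → S.E x₁ x₂ × φ.to x₁ Y.≈ y₁ × φ.to x₂ Y.≈ y₂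
    ; E?       = λ y₁ y₂ → X.∃?
        (λ x≈x′ (x₂ , e , p , q) → x₂ , proj₂ S.E-resp x≈x′ e , along x≈x′ p , q)
        (λ x₁ → X.∃?
          (λ x≈x′ (e , p , q) → proj₁ S.E-resp x≈x′ e , p , along x≈x′ q)
          (λ x₂ → S.E? x₁ x₂ ×-dec (φ.to x₁ Y.≟ y₁) ×-dec (φ.to x₂ Y.≟ y₂)))
    ; E-resp   = (λ y≈y′ (x₁ , x₂ , e , p , q) → x₁ , x₂ , e , p , Y.≈-trans q y≈y′)
               , (λ y≈y′ (x₁ , x₂ , e , p , q) → x₁ , x₂ , e , Y.≈-trans p y≈y′ , q)
    ; E-refl   = λ (x , v , p) → x , x , S.E-refl v , p , p
    ; E-sym    = λ (x₁ , x₂ , e , p , q) → x₂ , x₁ , S.E-sym e , q , p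
    ; E⇒V      = λ (x₁ , _ , e , p , _) → x₁ , S.E⇒V e , p
    ; E⇒Edge   = λ (_ , _ , e , p , q) →
        proj₁ Y.Edge-resp q (proj₂ Y.Edge-resp p (φ.edge (S.E⇒Edge e)))
    }
    where
    module S = Subgraph S
    along : ∀ {x x′ y} → x X.≈ x′ → φ.to x Y.≈ y → φ.to x′ Y.≈ y
    along x≈x′ = Y.≈-trans (φ.cong (X.≈-sym x≈x′))

  -- k φ S y is k_S(y), the size of V_S ∩ φ⁻¹(y).
  k : Subgraph X → Y.Vertex → ℕ
  k S y = X.# (λ x → Subgraph.V? S x ×-dec (φ.to x Y.≟ y))

  -- 𝒞(X)_{C′} for a component C′ of Y.
  ComponentOver : Subgraph Y → Set₁
  ComponentOver C′ = Σ[ C ∈ Component X ] image (proj₁ C) ⊆ C′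

  -- c(X)_y, the number of components C of X with k_C(y) > 0.
  c-at : Y.Vertex → ℕ
  c-at y = FiniteSet.# (𝒞 X) (λ (C , _) → k C y >? 0)

record VertexEquivalence (Z : Graph) : Set₁ where
  private module Z = Graph Z
  infix 4 _∼_
  field
    _∼_              : Rel Z.Vertex 0ℓ
    isDecEquivalence : IsDecEquivalence _∼_
    ≈⇒∼              : Z._≈_ ⇒ _∼_
  open IsDecEquivalence isDecEquivalence public
    renaming (_≟_ to _∼?_; refl to ∼-refl; sym to ∼-sym; trans to ∼-trans)

infixl 7 _/_

_/_ : (Z : Graph) → VertexEquivalence Z → Graph
Z / R = record
  { vertices  = record
    { decSetoid = record { isDecEquivalence = isDecEquivalence }
    ; elements  = Z.elements
    ; complete  = λ z → Any.map ≈⇒∼ (Z.complete z)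
    }
  ; nonempty  = Z.nonempty
  ; Edge      = λ z₁ z₂ → ∃ λ w₁ → ∃ λ w₂ → w₁ ∼ z₁ × w₂ ∼ z₂ × Z.Edge w₁ w₂
  ; Edge?     = λ z₁ z₂ → Z.∃?
      (λ w≈w′ (w₂ , p , q , e) → w₂ , along w≈w′ p , q , proj₂ Z.Edge-resp w≈w′ e)
      (λ w₁ → Z.∃?
        (λ w≈w′ (p , q , e) → p , along w≈w′ q , proj₁ Z.Edge-resp w≈w′ e)
        (λ w₂ → (w₁ ∼? z₁) ×-dec (w₂ ∼? z₂) ×-dec Z.Edge? w₁ w₂))
  ; Edge-resp = (λ z∼z′ (w₁ , w₂ , p , q , e) → w₁ , w₂ , p , ∼-trans q z∼z′ , e)
              , (λ z∼z′ (w₁ , w₂ , p , q , e) → w₁ , w₂ , ∼-trans p z∼z′ , q , e)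
  ; Edge-refl = λ {z} → z , z , ∼-refl , ∼-refl , Z.Edge-refl
  ; Edge-sym  = λ (w₁ , w₂ , p , q , e) → w₂ , w₁ , q , p , Z.Edge-sym e
  }
  where
  module Z = Graph Z
  open VertexEquivalence R
  along : ∀ {w w′ z} → w Z.≈ w′ → w ∼ z → w′ ∼ z
  along w≈w′ = ∼-trans (≈⇒∼ (Z.≈-sym w≈w′))

∼[_] : {X Y : Graph} → Hom X Y → VertexEquivalence X
∼[_] {Y = Y} φ = record
  { _∼_              = Graph._≈_ Y on Hom.to φ
  ; isDecEquivalence = On.isDecEquivalence (Hom.to φ) (Graph.≈-isDecEquivalence Y)
  ; ≈⇒∼              = Hom.cong φ
  }

_↾_ : {X : Graph} → VertexEquivalence X → (S : Subgraph X) → VertexEquivalence ⌞ S ⌟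
R ↾ S = record
  { _∼_              = R._∼_ on proj₁
  ; isDecEquivalence = On.isDecEquivalence proj₁ R.isDecEquivalence
  ; ≈⇒∼              = R.≈⇒∼
  }
  where module R = VertexEquivalence R

{-# OPTIONS --safe #-}

-- A locally surjective homomorphism lifts walks: a walk in Y starting at φ x is
-- covered by a walk in X starting at x. Hence φ maps the component of x onto the
-- component of φ x, which gives (i)–(iii). For (iv), every component C of X lies
-- over exactly one component of Y, and y_i ∈ φ(C) holds exactly when that
-- component is the one of y_i; since the c(Y) vertices y_i meet all c(Y)
-- components, distinct indices give distinct components, so each C is counted once.
module Submission where

open import Defs
open import Data.Fin.Base using (Fin; zero; suc; punchOut)
open import Data.Fin.Properties using (_≟_; any?; injective⇒≤; punchOut-injective; suc-injective; 0≢1+n)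
open import Data.List.Base using (List; []; _∷_; filter; length; lookup; sum; tabulate)
open import Data.List.Membership.Propositional.Properties using (∈-lookup)
open import Data.List.Membership.Setoid using (lose)
open import Data.List.Properties using (filter-accept; filter-none; filter-reject; filter-some; tabulate-cong)
open import Data.List.Relation.Unary.All as All using (_∷_)
open import Data.List.Relation.Unary.All.Properties using (¬Any⇒All¬)
open import Data.List.Relation.Unary.AllPairs using (_∷_)
import Data.List.Relation.Unary.Any as Any
open import Data.List.Relation.Unary.Enumerates.Setoid.Properties using (deduplicate⁺)
open import Data.List.Relation.Unary.Unique.DecSetoid.Properties using (deduplicate-!)
open import Data.List.Relation.Unary.Unique.Setoid using (Unique)
open import Data.Nat.Base using (ℕ; zero; suc; _+_; _>_)
open import Data.Nat.Properties using (+-suc; 1+n≰n; n≮0)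
open import Data.Product.Base using (_×_; _,_; ∃; proj₁; proj₂)
open import Function.Base using (_∘_)
open import Function.Bundles using (_⇔_; mk⇔; Equivalence)
open import Function.Definitions using (Injective)
open import Level using (Lift; lift)
open import Relation.Binary.Bundles using (Setoid)
open import Relation.Binary.Construct.Closure.ReflexiveTransitive using (Star; ε; _◅_; _◅◅_; gmap)
open import Relation.Binary.Definitions using (_Respects_)
open import Relation.Binary.PropositionalEquality using (_≡_; _≢_; refl; sym; trans; cong; cong₂; subst)
open import Relation.Nullary.Decidable using (yes; no)
open import Relation.Nullary.Negation using (contradiction)
open import Relation.Unary using (Decidable; Pred; _≐_; ⋃)

-- Pigeonhole and counting in finite sets.

injective⇒onto : ∀ {n} {f : Fin n → Fin n} → Injective _≡_ _≡_ f → ∀ i → ∃ λ j → f j ≡ i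
injective⇒onto {suc n} {f} f-inj i with any? (λ j → f j ≟ i)
... | yes hit = hit
-- Punching the missed `i` out of the codomain would inject `Fin (suc n)` into `Fin n`.
... | no miss = contradiction (injective⇒≤ avoid-injective) 1+n≰n
  where
  i≢f : ∀ j → i ≢ f j
  i≢f j i≡fj = miss (j , sym i≡fj)

  avoid-injective : Injective _≡_ _≡_ (λ j → punchOut (i≢f j))
  avoid-injective {j} {k} eq = f-inj (punchOut-injective (i≢f j) (i≢f k) eq)

module _ {a ℓ} (S : Setoid a ℓ) where
  open Setoid S using (Carrier; _≈_) renaming (sym to ≈-sym)

  lookup-injective : ∀ {xs : List Carrier} → Unique S xs →
                     ∀ i j → lookup xs i ≈ lookup xs j → i ≡ j
  lookup-injective (_ ∷ _)   zero    zero    _  = refl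
  lookup-injective (x∉ ∷ _)  zero    (suc j) eq = contradiction eq (All.lookup x∉ (∈-lookup j))
  lookup-injective (x∉ ∷ _)  (suc i) zero    eq = contradiction (≈-sym eq) (All.lookup x∉ (∈-lookup i))
  lookup-injective (_ ∷ xs!) (suc i) (suc j) eq = cong suc (lookup-injective xs! i j eq)

module _ {a ℓ} (A : FiniteSet a ℓ) where
  private module A = FiniteSet A

  -- Choosing for each representative an index at which `f` hits it gives an injective self-map of
  -- `Fin A.card`. By pigeonhole it reaches every index, and on the chosen indices `f` separates
  -- points because representatives are pairwise inequivalent.
  onto⇒injective : (f : Fin A.card → A.Carrier) → (∀ x → ∃ λ i → x A.≈ f i) →
                   ∀ {i j} → f i A.≈ f j → i ≡ j
  onto⇒injective f onto fi≈fj =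
    on-indices (injective⇒onto index-injective _) (injective⇒onto index-injective _) fi≈fj
    where
    index : Fin A.card → Fin A.card
    index r = proj₁ (onto (lookup A.representatives r))

    ≈f∘index : ∀ r → lookup A.representatives r A.≈ f (index r)
    ≈f∘index r = proj₂ (onto (lookup A.representatives r))

    f∘index-injective : ∀ r s → f (index r) A.≈ f (index s) → r ≡ s
    f∘index-injective r s eq =
      lookup-injective A.setoid (deduplicate-! A.decSetoid A.elements) r s
        (A.trans (≈f∘index r) (A.trans eq (A.sym (≈f∘index s))))

    index-injective : Injective _≡_ _≡_ index
    index-injective eq = f∘index-injective _ _ (A.reflexive (cong f eq))

    on-indices : ∀ {i j} → ∃ (λ r → index r ≡ i) → ∃ (λ s → index s ≡ j) →
                 f i A.≈ f j → i ≡ j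
    on-indices (r , refl) (s , refl) eq = cong index (f∘index-injective r s eq)

  module _ {p} {P : Pred A.Carrier p} (P? : Decidable P) where

    ∃⇒#>0 : P Respects A._≈_ → ∃ P → A.# P? > 0
    ∃⇒#>0 resp (x , px) = filter-some P?
      -- `#` counts representatives only, so `resp` moves the witness to its representative.
      (lose A.setoid resp (deduplicate⁺ A.decSetoid A.complete x) px)

    #>0⇒∃ : A.# P? > 0 → ∃ P
    #>0⇒∃ #>0 with Any.any? P? A.representatives
    ... | yes any = Any.satisfied any
    ... | no none = contradiction
      (subst (λ xs → length xs > 0) (filter-none P? (¬Any⇒All¬ _ none)) #>0) n≮0

-- Serves the induction over a list: a new element raises exactly one of the counts.
sum-tabulate-suc : ∀ {n} {f g : Fin n → ℕ} i → f i ≡ suc (g i) →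
                   (∀ j → i ≢ j → f j ≡ g j) →
                   sum (tabulate f) ≡ suc (sum (tabulate g))
sum-tabulate-suc zero fi≡ f≡g =
  cong₂ _+_ fi≡ (cong sum (tabulate-cong (λ j → f≡g (suc j) 0≢1+n)))
sum-tabulate-suc {g = g} (suc i) fi≡ f≡g = trans
  (cong₂ _+_ (f≡g zero (0≢1+n ∘ sym))
    (sum-tabulate-suc i fi≡ (λ j i≢j → f≡g (suc j) (i≢j ∘ suc-injective))))
  (+-suc (g zero) _)

sum-tabulate-0 : ∀ n → sum (tabulate {n = n} (λ _ → 0)) ≡ 0
sum-tabulate-0 zero    = refl
sum-tabulate-0 (suc n) = sum-tabulate-0 n

-- Double counting: the `P i` partition the elements, so each entry of the list survives exactly one
-- of the filters.
length≡sum-filter : ∀ {a p n} {A : Set a} {P : Fin n → Pred A p} (P? : ∀ i → Decidable (P i)) →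
                    (∀ x → ∃ λ i → P i x × (∀ j → P j x → i ≡ j)) →
                    ∀ xs → length xs ≡ sum (tabulate (λ i → length (filter (P? i) xs)))
length≡sum-filter {n = n} P? unique [] = sym (sum-tabulate-0 n)
length≡sum-filter P? unique (x ∷ xs) with i , pix , only ← unique x = trans
  (cong suc (length≡sum-filter P? unique xs))
  (sym (sum-tabulate-suc i
    (cong length (filter-accept (P? i) pix))
    (λ j i≢j → cong length (filter-reject (P? j) (i≢j ∘ only j)))))

-- Subgraphs and components up to `≋`.

module _ {X : Graph} where
  -- The loops added at both ends exchange the membership proofs of the endpoints.
  Star-resp-⊆ : (S T : Subgraph X) → S ⊆ T →
                ∀ {x y} (x∈S : Subgraph.V S x) (y∈S : Subgraph.V S y)
                  (x∈T : Subgraph.V T x) (y∈T : Subgraph.V T y) →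
                Star (Graph.Edge ⌞ S ⌟) (x , x∈S) (y , y∈S) →
                Star (Graph.Edge ⌞ T ⌟) (x , x∈T) (y , y∈T)
  Star-resp-⊆ S T S⊆T x∈S y∈S x∈T y∈T p =
    T.E-refl x∈T ◅ gmap (λ (z , z∈S) → z , V⊆ S⊆T z∈S) (E⊆ S⊆T) p ◅◅ T.E-refl y∈T ◅ ε
    where module T = Subgraph T

  IsComponent-resp-≋ : {S T : Subgraph X} → S ≋ T → IsComponent S → IsComponent T
  IsComponent-resp-≋ {S} {T} (S⊆T , T⊆S) isC = record
    { connected = λ (x , x∈T) (y , y∈T) →
        Star-resp-⊆ S T S⊆T (V⊆ T⊆S x∈T) (V⊆ T⊆S y∈T) x∈T y∈T (C.connected _ _)
    ; maximal   = λ D conn T⊆D → ⊆-trans (C.maximal D conn (⊆-trans S⊆T T⊆D)) S⊆T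
    }
    where module C = IsComponent isC

  ≋-sym : {S T : Subgraph X} → S ≋ T → T ≋ S
  ≋-sym (p , q) = q , p

  ≋-trans : {S T U : Subgraph X} → S ≋ T → T ≋ U → S ≋ U
  ≋-trans (p , q) (p′ , q′) = ⊆-trans p p′ , ⊆-trans q′ q

-- Images under an arbitrary homomorphism.

module _ {X Y : Graph} (φ : Hom X Y) where
  private
    module X = Graph X
    module Y = Graph Y
    module φ = Hom φ

  image-mono : {S T : Subgraph X} → S ⊆ T → image φ S ⊆ image φ T
  image-mono S⊆T = mk⊆
    (λ (x , x∈S , p) → x , V⊆ S⊆T x∈S , p)
    (λ (x₁ , x₂ , e , p , q) → x₁ , x₂ , E⊆ S⊆T e , p , q)

  image-cong : {S T : Subgraph X} → S ≋ T → image φ S ≋ image φ T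
  image-cong (S⊆T , T⊆S) = image-mono S⊆T , image-mono T⊆S

  Star-map : ∀ {x x′ y} → Star X.Edge x x′ → φ.to x′ Y.≈ y → Star Y.Edge (φ.to x) y
  Star-map p φx′≈y = gmap φ.to φ.edge p ◅◅ Y.≈⇒Edge φx′≈y ◅ ε

  image-componentOf-⊆ : ∀ x → image φ (componentOf X x) ⊆ componentOf Y (φ.to x)
  image-componentOf-⊆ x = mk⊆
    (λ (_ , p , q) → Star-map p q)
    (λ i@(_ , _ , (p , _) , q , _) →
      Star-map p q , Subgraph.E⇒Edge (image φ (componentOf X x)) i)

  -- Turns the counting condition in `c-at` into membership of `y` in the image.
  k>0⇔ : ∀ (S : Subgraph X) y → k φ S y > 0 ⇔ imageSet φ (Subgraph.V S) y
  k>0⇔ S y = mk⇔ (#>0⇒∃ X.vertices _)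
    (∃⇒#>0 X.vertices _ (λ x≈x′ (x∈S , φx≈y) →
      Subgraph.V-resp S x≈x′ x∈S , Y.≈-trans (φ.cong (X.≈-sym x≈x′)) φx≈y))

  -- Consequences of local surjectivity.

  module _ (ls : LocallySurjective φ) where

    Edge-lift : ∀ {x y y′} → φ.to x Y.≈ y → Y.Edge y y′ → ∃ λ x′ → X.Edge x x′ × φ.to x′ Y.≈ y′
    Edge-lift {x} φx≈y e = proj₂ (ls x) (proj₂ Y.Edge-resp (Y.≈-sym φx≈y) e)

    -- Starting only up to `≈` keeps the induction going: a lifted edge ends over the next vertex of
    -- the walk up to `≈`, not on the nose.
    Star-lift : ∀ {x y y′} → φ.to x Y.≈ y → Star Y.Edge y y′ →
                ∃ λ x′ → Star X.Edge x x′ × φ.to x′ Y.≈ y′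
    Star-lift φx≈y ε = _ , ε , φx≈y
    Star-lift φx≈y (e ◅ es) with _ , e′ , φz≈ ← Edge-lift φx≈y e
      with _ , es′ , φx′≈ ← Star-lift φz≈ es = _ , e′ ◅ es′ , φx′≈

    image-componentOf : ∀ x → image φ (componentOf X x) ≋ componentOf Y (φ.to x)
    image-componentOf x = image-componentOf-⊆ x , mk⊆ (Star-lift Y.≈-refl) E-lift
      where
      E-lift : ∀ {y z} → Star Y.Edge (φ.to x) y × Y.Edge y z →
               Subgraph.E (image φ (componentOf X x)) y z
      -- The edge is lifted from the end of the lifted walk; lifting its two ends separately need
      -- not give adjacent vertices.
      E-lift (p , e) with _ , p′ , φw≈y ← Star-lift Y.≈-refl p
        with _ , e′ , φw′≈z ← Edge-lift φw≈y e = _ , _ , (p′ , e′) , φw≈y , φw′≈z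

    image-isComponent : ∀ (C : Subgraph X) → IsComponent C → IsComponent (image φ C)
    image-isComponent C isC =
      let x , x∈C = Subgraph.nonempty C in
      IsComponent-resp-≋
        (≋-sym (≋-trans (image-cong (component≋ (C , isC) x∈C)) (image-componentOf x)))
        (componentOf-isComponent (φ.to x))

    image-isUnionOfComponents : IsUnionOfComponents (image φ (whole X))
    image-isUnionOfComponents = Meets
      , (λ y → mk⇔
          (λ (x , _ , φx≈y) → component x , meets x , Y.≈⇒Edge φx≈y ◅ ε)
          (λ (D , lift (x , φx∈D) , y∈D) →
            let x′ , _ , p = Star-lift Y.≈-refl (V⊆ (proj₁ (component≋ D φx∈D)) y∈D) in
            x′ , _ , p))
      , (λ y z → mk⇔
          (λ i@(x , _ , _ , φx≈y , _) → component x , meets x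
            , Y.≈⇒Edge φx≈y ◅ ε , Subgraph.E⇒Edge (image φ (whole X)) i)
          (λ (D , lift (x , φx∈D) , e) →
            let x₁ , x₂ , (_ , e′) , p , q =
                  E⊆ (proj₂ (image-componentOf x)) (E⊆ (proj₁ (component≋ D φx∈D)) e)
            in x₁ , x₂ , e′ , p , q))
      where
      -- A component of `Y` with one vertex in the image lies wholly in it, by lifting walks from
      -- that vertex. `Lift` only adjusts the universe level.
      Meets : Pred (Component Y) _
      Meets (D , _) = Lift _ (∃ λ x → Subgraph.V D (φ.to x))

      component : X.Vertex → Component Y
      component x = componentOf Y (φ.to x) , componentOf-isComponent (φ.to x)

      meets : ∀ x → Meets (component x)
      meets x = lift (x , ε)

    -- The map sends a vertex to the end of a lifted walk. That end depends on the walk chosen, but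
    -- any two choices have equal images and so agree in the quotient.
    componentOf≅quotient : ∀ x →
      ⌞ componentOf Y (φ.to x) ⌟ ≅ ⌞ componentOf X x ⌟ / (∼[ φ ] ↾ componentOf X x)
    componentOf≅quotient x = record
      { hom = record
        { to   = λ (_ , p) → to p
        ; cong = λ {(_ , p)} {(_ , q)} → to-cong p q
        -- The chosen lifts of the two ends need not be adjacent; an edge lifted as a whole supplies
        -- adjacent vertices in the same classes.
        ; edge = λ {(_ , p)} {(_ , q)} (_ , e) →
            let x₁ , x₂ , e′ , φx₁≈ , φx₂≈ = E⊆ (proj₂ (image-componentOf x)) (p , e) in
            (x₁ , proj₁ e′) , (x₂ , proj₁ e′ ◅◅ proj₂ e′ ◅ ε)
              , Y.≈-trans φx₁≈ (Y.≈-sym (to-≈ p)) , Y.≈-trans φx₂≈ (Y.≈-sym (to-≈ q)) , e′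
        }
      ; bijective =
          (λ {(_ , p)} {(_ , q)} eq → Y.≈-trans (Y.≈-sym (to-≈ p)) (Y.≈-trans eq (to-≈ q)))
        , (λ (x′ , p) → (φ.to x′ , Star-map p Y.≈-refl) , λ {(_ , q)} → Y.≈-trans (to-≈ q))
      -- The lifts chosen over the images of `w₁` and `w₂` may differ from them, but lie in the same
      -- fibres.
      ; edge-onto = λ ((w₁ , p) , (w₂ , q) , w₁∼ , w₂∼ , (_ , e)) →
          let p′ = Star-map p Y.≈-refl
              q′ = Star-map q Y.≈-refl
          in (φ.to w₁ , p′) , (φ.to w₂ , q′) , (p′ , φ.edge e)
            , Y.≈-trans (to-≈ p′) w₁∼ , Y.≈-trans (to-≈ q′) w₂∼
      }
      where
      to : ∀ {y} → Star Y.Edge (φ.to x) y → ∃ (Star X.Edge x)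
      to p = let x′ , p′ , _ = Star-lift Y.≈-refl p in x′ , p′

      to-≈ : ∀ {y} (p : Star Y.Edge (φ.to x) y) → φ.to (proj₁ (to p)) Y.≈ y
      to-≈ p = proj₂ (proj₂ (Star-lift Y.≈-refl p))

      to-cong : ∀ {y z} (p : Star Y.Edge (φ.to x) y) (q : Star Y.Edge (φ.to x) z) →
                y Y.≈ z → φ.to (proj₁ (to p)) Y.≈ φ.to (proj₁ (to q))
      to-cong p q y≈z = Y.≈-trans (to-≈ p) (Y.≈-trans y≈z (Y.≈-sym (to-≈ q)))

    -- For the first inclusion the component of `x` itself works: its image lies in the component of
    -- `φ.to x`, which is `image φ C` because the latter is a component containing `φ.to x`.
    preimage-image : ∀ (C : Subgraph X) → IsComponent C →
      preimageSet φ (imageSet φ (Subgraph.V C))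
        ≐ ⋃ (ComponentOver φ (image φ C)) (λ Ĉ → Subgraph.V (proj₁ (proj₁ Ĉ)))
    preimage-image C isC =
        (λ {x} φx∈φC → ((componentOf X x , componentOf-isComponent x)
          , ⊆-trans (image-componentOf-⊆ x)
              (proj₂ (component≋ (image φ C , image-isComponent C isC) φx∈φC))) , ε)
      , (λ {x} ((_ , φĈ⊆φC) , x∈Ĉ) → V⊆ φĈ⊆φC (x , x∈Ĉ , Y.≈-refl))

    c≡sum-c-at : (y : Fin (c Y) → Y.Vertex) →
      (∀ (D : Subgraph Y) → IsComponent D ⇔ ∃ (λ i → D ≋ componentOf Y (y i))) →
      c X ≡ sum (tabulate (λ i → c-at φ (y i)))
    c≡sum-c-at y y-represents = length≡sum-filter _ over-one (FiniteSet.representatives (𝒞 X))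
      where
      index : ∀ (D : Component Y) → ∃ (λ i → proj₁ D ≋ componentOf Y (y i))
      index (D , isD) = Equivalence.to (y-represents D) isD

      over-one : ∀ (C : Component X) → ∃ λ i → k φ (proj₁ C) (y i) > 0
                   × (∀ j → k φ (proj₁ C) (y j) > 0 → i ≡ j)
      -- The index is that of the component `image φ C`, which contains `y i` by the empty walk.
      over-one (C , isC) with i , φC≋ ← index (image φ C , image-isComponent C isC) =
          i
        , Equivalence.from (k>0⇔ C (y i)) (V⊆ (proj₂ φC≋) ε)
        -- If `y j` also lies in `image φ C`, then `y i` and `y j` have the same component. As the
        -- `c Y` listed components exhaust `𝒞 Y`, none is listed twice.
        , λ j k>0 → onto⇒injective (𝒞 Y)
            (λ i → componentOf Y (y i) , componentOf-isComponent (y i)) index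
            (≋-trans (≋-sym φC≋)
              (component≋ (image φ C , image-isComponent C isC)
                (Equivalence.to (k>0⇔ C (y j)) k>0)))

theoremA : (X Y : Graph) (φ : Hom X Y) → LocallySurjective φ →
    ( (∀ (C : Subgraph X) → IsComponent C → IsComponent (image φ C))
    × IsUnionOfComponents (image φ (whole X)) )
    × (∀ (x : Graph.Vertex X) →
    image φ (componentOf X x) ≋ componentOf Y (Hom.to φ x)
    × ⌞ componentOf Y (Hom.to φ x) ⌟
    ≅ ⌞ componentOf X x ⌟ / (∼[ φ ] ↾ componentOf X x))
    × (∀ (C : Subgraph X) → IsComponent C →
    preimageSet φ (imageSet φ (Subgraph.V C))
    ≐ ⋃ (ComponentOver φ (image φ C)) (λ Ĉ → Subgraph.V (proj₁ (proj₁ Ĉ))))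
    × (∀ (y : Fin (c Y) → Graph.Vertex Y) →
    (∀ (D : Subgraph Y) → IsComponent D ⇔ ∃ (λ i → D ≋ componentOf Y (y i))) →
    c X ≡ sum (tabulate (λ i → c-at φ (y i))))
theoremA X Y φ ls =
    (image-isComponent φ ls , image-isUnionOfComponents φ ls)
  , (λ x → image-componentOf φ ls x , componentOf≅quotient φ ls x)
  , preimage-image φ ls
  , c≡sum-c-at φ ls
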